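{- Let $\Gamma$ be a finite connected bipartite graph with ordered bipartition $(B|B')$, let $G\leq\mathrm{Aut}(\Gamma)$, let $1\neq N\lhd G$, and let $r\geq 3$ be an integer. Suppose that the following two conditions hold: (a) $\Gamma$ is $r$-starlike relative to $N$, and $\Gamma$ is locally $(G,4)$-distance transitive; (b) the adjacency design $\mathcal{D}(\Gamma)$ is $G$-pairwise transitive and $N$-nicely affine with $r$ parallel classes of blocks. Then $G^B\cong G$ (that is, $G$ acts faithfully on $B$) and $G^B$ has rank $2$ or $3$; $G^{B'}\cong G$ (that is, $G$ acts faithfully on $B'$) and $G^{B'}$ is imprimitive of rank $3$; and for every $x\in B$, $G_x^{\Gamma(x)}$ is $2$-transitive of degree $r$.
   Context: All graphs are finite, simple and without loops. (Conditions (a) and (b) are the equivalent conditions characterised in the paper.) For a $G$-invariant (or $G_x$-invariant) set $X$, $G^X$ (or $G_x^X$) denotes the permutation group induced on $X$; the action of $G$ on $X$ is faithful if $G^X\cong G$. $\Gamma(x)$ is the set of neighbours of $x$. The rank of a transitive permutation group is the number of orbits of a point stabiliser; groups of rank $2$ are called $2$-transitive. Locally $(G,s)$-distance transitive: the graph has diameter at least $s$, $G$ is a subgroup of its automorphism group, and for each vertex $v$ and each $1\leq i\leq s$ the stabiliser $G_v$ is transitive on the set of vertices at distance $i$ from $v$. $r$-starlike: a connected bipartite graph with ordered bipartition $(B|B')$ is $r$-starlike relative to $N$ if $N\leq\mathrm{Aut}(\Gamma)$, $r\geq2$, $N$ is transitive on $B$, and $N$ has exactly $r$ orbits on $B'$.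 A design $\mathcal{D}=(\mathcal{P},\mathcal{B},\mathcal{I})$ consists of a point set, a block set and an incidence relation $\mathcal{I}\subseteq\mathcal{P}\times\mathcal{B}$. An automorphism is a permutation of $\mathcal{P}\cup\mathcal{B}$ preserving points, blocks and incidence. Two distinct points are collinear if incident with at least one common block, otherwise non-collinear; two distinct blocks are intersecting if incident with at least one common point, otherwise non-intersecting. The adjacency design $\mathcal{D}(\Gamma)$ has point set $B$, block set $B'$, with incidence given by adjacency in $\Gamma$. $G$-pairwise transitive: $G$ is a group of automorphisms of the design transitive on each of the following six (possibly empty) sets: incident and non-incident point-block pairs, collinear and non-collinear point pairs, intersecting and non-intersecting block pairs (ordered pairs of distinct elements). $N$-nicely affine: $N$ is a group of automorphisms transitive on points, and there is a constant $\mu$ such that distinct blocks are incident with exactly $\mu$ common points if they are in different $N$-orbits and with no common point if they are in the same $N$-orbit. The $N$-orbits on blocks are the parallel classes. -}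

module Defs where

open import Algebra.Bundles using (Group)
open import Algebra.Morphism.Structures using (module GroupMorphisms)
open import Data.Fin.Base using (Fin)
open import Data.Fin.Subset using (Subset; _∈_; _∉_; ∁; ∣_∣)
open import Data.Nat.Base using (ℕ; zero; suc; _≤_; _<_)
open import Data.Product.Base using (Σ; ∃; ∃-syntax; _×_; _,_; proj₁; proj₂)
open import Data.Sum.Base using (_⊎_)
open import Function.Bundles using (_↔_; _⇔_; Inverse)
open import Function.Construct.Composition using (_↔-∘_; _⇔-∘_)
open import Function.Construct.Identity using (↔-id; ⇔-id)
open import Function.Construct.Symmetry using (↔-sym; ⇔-sym)
open import Function.Definitions using (Surjective)
open import Level using (0ℓ)
open import Relation.Binary.Core using (Rel)
open import Relation.Binary.Structures using (IsEquivalence)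
open import Relation.Binary.PropositionalEquality
  using (_≡_; _≢_; refl; sym; trans; cong)
open import Relation.Nullary.Negation using (¬_)
open import Relation.Unary using (Pred)

private
  variable
    A : Set
    n : ℕ

------------------------------------------------------------------------
-- Permutation groups

infixr 8 _·_

_·_ : A ↔ A → A → A
_·_ = Inverse.to

infix 4 _≈_

_≈_ : Rel (A ↔ A) 0ℓ
g ≈ h = ∀ x → g · x ≡ h · x

private
  to-from : (g : A ↔ A) (x : A) → g · Inverse.from g x ≡ x
  to-from g x = Inverse.inverseˡ g refl

  from-to : (g : A ↔ A) (x : A) → Inverse.from g (g · x) ≡ x
  from-to g x = Inverse.inverseʳ g refl

  from-cong : {g h : A ↔ A} → g ≈ h → ↔-sym g ≈ ↔-sym h
  from-cong {g = g} {h} g≈h x =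
    trans (cong (Inverse.from g)
                (sym (trans (g≈h (Inverse.from h x)) (to-from h x))))
          (from-to g (Inverse.from h x))

-- A subgroup of Sym(A).
record PermGroup (A : Set) : Set₁ where
  field
    member   : Pred (A ↔ A) 0ℓ
    resp-≈   : ∀ {g h} → g ≈ h → member g → member h
    id-mem   : member (↔-id A)
    comp-mem : ∀ {g h} → member g → member h → member (g ↔-∘ h)
    inv-mem  : ∀ {g} → member g → member (↔-sym g)

infix 4 _∋_ _≤ᴳ_ _⊴_

_∋_ : PermGroup A → A ↔ A → Set
_∋_ = PermGroup.member

_≤ᴳ_ : PermGroup A → PermGroup A → Set
H ≤ᴳ G = ∀ {g} → H ∋ g → G ∋ g

_⊴_ : PermGroup A → PermGroup A → Set
N ⊴ G = N ≤ᴳ G × (∀ {g h} → G ∋ g → N ∋ h → N ∋ g ↔-∘ (h ↔-∘ ↔-sym g))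

IsTrivial : PermGroup A → Set
IsTrivial G = ∀ {g} → G ∋ g → g ≈ ↔-id _

toGroup : PermGroup A → Group 0ℓ 0ℓ
toGroup {A} G = record
  { Carrier = ∃ (G ∋_)
  ; _≈_     = λ g h → proj₁ g ≈ proj₁ h
  ; _∙_     = λ (g , g∈) (h , h∈) → g ↔-∘ h , comp-mem g∈ h∈
  ; ε       = ↔-id A , id-mem
  ; _⁻¹     = λ (g , g∈) → ↔-sym g , inv-mem g∈
  ; isGroup = record
    { isMonoid = record
      { isSemigroup = record
        { isMagma = record
          { isEquivalence = record
            { refl  = λ x → refl
            ; sym   = λ p x → sym (p x)
            ; trans = λ p q x → trans (p x) (q x)
            }
          ; ∙-cong = λ {_} {g′} {h} p q x →
              trans (p (proj₁ h · x)) (cong (proj₁ g′ ·_) (q x))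
          }
        ; assoc = λ _ _ _ x → refl
        }
      ; identity = (λ _ x → refl) , (λ _ x → refl)
      }
    ; inverse = (λ (g , _) → from-to g) , (λ (g , _) → to-from g)
    ; ⁻¹-cong = λ {g} {h} → from-cong {g = proj₁ g} {h = proj₁ h}
    }
  }
  where open PermGroup G

Stab : PermGroup A → A → PermGroup A
Stab G a = record
  { member   = λ g → G ∋ g × g · a ≡ a
  ; resp-≈   = λ g≈h (g∈ , ga≡a) → resp-≈ g≈h g∈ , trans (sym (g≈h a)) ga≡a
  ; id-mem   = id-mem , refl
  ; comp-mem = λ {g} (g∈ , ga≡a) (h∈ , ha≡a) →
      comp-mem g∈ h∈ , trans (cong (g ·_) ha≡a) ga≡a
  ; inv-mem  = λ {g} (g∈ , ga≡a) →
      inv-mem g∈ , trans (cong (Inverse.from g) (sym ga≡a)) (from-to g a)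
  }
  where open PermGroup G

SameOrbit : PermGroup A → Rel A 0ℓ
SameOrbit G x y = ∃[ g ] G ∋ g × g · x ≡ y

TransitiveOn : PermGroup A → Pred A 0ℓ → Set
TransitiveOn G P = ∀ {x y} → P x → P y → SameOrbit G x y

TransitiveOnPairs : PermGroup A → Rel A 0ℓ → Set
TransitiveOnPairs G R = ∀ {x y x′ y′} → R x y → R x′ y′ →
  ∃[ g ] G ∋ g × g · x ≡ x′ × g · y ≡ y′

Transitive : PermGroup A → Set
Transitive G = ∀ x y → SameOrbit G x y

-- The fibres of the colouring are the orbits.
HasOrbits : PermGroup A → ℕ → Set
HasOrbits {A} G k = Σ (A → Fin k) λ c →
  Surjective _≡_ _≡_ c × (∀ x y → c x ≡ c y ⇔ SameOrbit G x y)

HasRank : PermGroup A → ℕ → Set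
HasRank {A} G k = A × Transitive G × (∀ a → HasOrbits (Stab G a) k)

TwoTransitive : PermGroup A → Set
TwoTransitive G = HasRank G 2

HasDegree : PermGroup A → ℕ → Set
HasDegree {A} G k = A ↔ Fin k

-- A transitive group preserving a partition (given as an equivalence
-- relation) other than the one into singletons and the one with a
-- single part.
Imprimitive : PermGroup A → Set₁
Imprimitive {A} G = Transitive G × Σ (Rel A 0ℓ) λ _~_ →
  IsEquivalence _~_
  × (∀ {g x y} → G ∋ g → x ~ y → (g · x) ~ (g · y))
  × (∃[ x ] ∃[ y ] x ≢ y × x ~ y)
  × (∃[ x ] ∃[ y ] ¬ (x ~ y))

------------------------------------------------------------------------
-- Induced groups on invariant sets

⟦_⟧ : Subset n → Set
⟦ X ⟧ = ∃ (_∈ X)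

Invariant : PermGroup (Fin n) → Subset n → Set
Invariant G X = ∀ {g x} → G ∋ g → x ∈ X → g · x ∈ X

Restricts : {X : Subset n} → ⟦ X ⟧ ↔ ⟦ X ⟧ → Fin n ↔ Fin n → Set
Restricts π g = ∀ u → proj₁ (π · u) ≡ g · proj₁ u

infix 9 _^_

-- The group of restrictions to X of elements of G; meant for
-- G-invariant X, where every element of G has a restriction.
_^_ : PermGroup (Fin n) → (X : Subset n) → PermGroup ⟦ X ⟧
G ^ X = record
  { member   = λ π → ∃[ g ] G ∋ g × Restricts π g
  ; resp-≈   = λ π≈ρ (g , g∈ , r) →
      g , g∈ , λ u → trans (cong proj₁ (sym (π≈ρ u))) (r u)
  ; id-mem   = ↔-id _ , id-mem , λ _ → refl
  ; comp-mem = λ {π} {ρ} (g , g∈ , r) (h , h∈ , s) →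
      g ↔-∘ h , comp-mem g∈ h∈ ,
      λ u → trans (r (ρ · u)) (cong (g ·_) (s u))
  ; inv-mem  = λ {π} (g , g∈ , r) → ↔-sym g , inv-mem g∈ , λ u →
      trans (sym (from-to g _))
            (cong (Inverse.from g)
                  (trans (sym (r (Inverse.from π u)))
                         (cong proj₁ (to-from π u))))
  }
  where open PermGroup G

-- G ≅ G^X, by way of the restriction homomorphism.
Faithful : PermGroup (Fin n) → Subset n → Set
Faithful G X = ∃[ f ] IsGroupIsomorphism f
                    × (∀ g → Restricts {X = X} (proj₁ (f g)) (proj₁ g))
  where open GroupMorphisms (Group.rawGroup (toGroup G))
                            (Group.rawGroup (toGroup (G ^ X)))

------------------------------------------------------------------------
-- Graphs

record Graph (n : ℕ) : Set where
  field
    nbr       : Fin n → Subset n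
    symmetric : ∀ {x y} → y ∈ nbr x → x ∈ nbr y
    loopless  : ∀ {x} → x ∉ nbr x

module _ (Γ : Graph n) where
  open Graph Γ

  data Walk : ℕ → Fin n → Fin n → Set where
    stop : ∀ {x} → Walk zero x x
    step : ∀ {k x y z} → y ∈ nbr x → Walk k y z → Walk (suc k) x z

  Connected : Set
  Connected = ∀ x y → ∃[ k ] Walk k x y

  Distance : ℕ → Fin n → Fin n → Set
  Distance i x y = Walk i x y × (∀ {j} → j < i → ¬ Walk j x y)

  Diameter : ℕ → Set
  Diameter d = (∃[ x ] ∃[ y ] Distance d x y)
             × (∀ x y → ∃[ e ] e ≤ d × Distance e x y)

  Aut : PermGroup (Fin n)
  Aut = record
    { member   = λ g → ∀ x y → y ∈ nbr x ⇔ g · y ∈ nbr (g · x)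
    ; resp-≈   = λ {g} {h} g≈h p x y →
        resp (g≈h x) (g≈h y) ⇔-∘ p x y
    ; id-mem   = λ x y → ⇔-id _
    ; comp-mem = λ {g} {h} p q x y → p (h · x) (h · y) ⇔-∘ q x y
    ; inv-mem  = λ {g} p x y →
        ⇔-sym (p (Inverse.from g x) (Inverse.from g y))
        ⇔-∘ resp (sym (to-from g x)) (sym (to-from g y))
    }
    where
    resp : ∀ {x y x′ y′} → x ≡ x′ → y ≡ y′ → y ∈ nbr x ⇔ y′ ∈ nbr x′
    resp refl refl = ⇔-id _

  record LocallyDistanceTransitive (G : PermGroup (Fin n)) (s : ℕ) : Set where
    field
      diameter≥s : ∃[ d ] Diameter d × s ≤ d
      G≤Aut      : G ≤ᴳ Aut
      transitive : ∀ v i → 1 ≤ i → i ≤ s →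
                   TransitiveOn (Stab G v) (Distance i v)

record Bipartition (Γ : Graph n) : Set where
  open Graph Γ
  field
    B : Subset n

  B′ : Subset n
  B′ = ∁ B

  field
    edges : ∀ {x y} → y ∈ nbr x → (x ∈ B × y ∈ B′) ⊎ (x ∈ B′ × y ∈ B)

-- Connectedness of Γ is assumed separately.
record Starlike {Γ : Graph n} (P : Bipartition Γ)
                (r : ℕ) (N : PermGroup (Fin n)) : Set where
  open Bipartition P
  field
    N≤Aut        : N ≤ᴳ Aut Γ
    r≥2          : 2 ≤ r
    B-invariant  : Invariant N B
    B′-invariant : Invariant N B′
    transitive   : TransitiveOn N (_∈ B)
    orbits       : HasOrbits (N ^ B′) r

------------------------------------------------------------------------
-- Designs

-- Points and blocks partition Fin n, so that Sym(Fin n) is the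
-- symmetric group on the union of the two sets.
record Design (n : ℕ) : Set₁ where
  infix 4 _I_
  field
    points : Subset n

  blocks : Subset n
  blocks = ∁ points

  field
    _I_   : Rel (Fin n) 0ℓ
    I-dom : ∀ {p β} → p I β → p ∈ points × β ∈ blocks

module _ (D : Design n) where
  open Design D

  record IsDesignAut (g : Fin n ↔ Fin n) : Set where
    field
      points-pres : ∀ x → x ∈ points ⇔ g · x ∈ points
      blocks-pres : ∀ x → x ∈ blocks ⇔ g · x ∈ blocks
      I-pres      : ∀ p β → p I β ⇔ g · p I g · β

  Incident NonIncident : Rel (Fin n) 0ℓ
  Incident    p β = p ∈ points × β ∈ blocks × p I β
  NonIncident p β = p ∈ points × β ∈ blocks × ¬ (p I β)

  Collinear NonCollinear : Rel (Fin n) 0ℓ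
  Collinear    p q = p ∈ points × q ∈ points × p ≢ q × (∃[ β ] p I β × q I β)
  NonCollinear p q = p ∈ points × q ∈ points × p ≢ q × ¬ (∃[ β ] p I β × q I β)

  Intersecting NonIntersecting : Rel (Fin n) 0ℓ
  Intersecting    β γ = β ∈ blocks × γ ∈ blocks × β ≢ γ × (∃[ p ] p I β × p I γ)
  NonIntersecting β γ = β ∈ blocks × γ ∈ blocks × β ≢ γ × ¬ (∃[ p ] p I β × p I γ)

  record PairwiseTransitive (G : PermGroup (Fin n)) : Set where
    field
      automorphisms   : ∀ {g} → G ∋ g → IsDesignAut g
      incident        : TransitiveOnPairs G Incident
      nonIncident     : TransitiveOnPairs G NonIncident
      collinear       : TransitiveOnPairs G Collinear
      nonCollinear    : TransitiveOnPairs G NonCollinear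
      intersecting    : TransitiveOnPairs G Intersecting
      nonIntersecting : TransitiveOnPairs G NonIntersecting

  CommonPoints : Fin n → Fin n → ℕ → Set
  CommonPoints β γ k = Σ (Subset n) λ S →
    (∀ p → p ∈ S ⇔ (p I β × p I γ)) × ∣ S ∣ ≡ k

  record NicelyAffine (N : PermGroup (Fin n)) : Set where
    field
      automorphisms : ∀ {g} → N ∋ g → IsDesignAut g
      transitive    : TransitiveOn N (_∈ points)
      μ             : ℕ
      different     : ∀ {β γ} → β ∈ blocks → γ ∈ blocks → β ≢ γ →
                      ¬ SameOrbit N β γ → CommonPoints β γ μ
      same          : ∀ {β γ} → β ∈ blocks → γ ∈ blocks → β ≢ γ →
                      SameOrbit N β γ → ¬ (∃[ p ] p I β × p I γ)

  HasParallelClasses : PermGroup (Fin n) → ℕ → Set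
  HasParallelClasses N r = HasOrbits (N ^ blocks) r

adjacencyDesign : {Γ : Graph n} → Bipartition Γ → Design n
adjacencyDesign {Γ = Γ} P = record
  { points = B
  ; _I_    = λ p β → p ∈ B × β ∈ B′ × β ∈ nbr p
  ; I-dom  = λ (p∈B , β∈B′ , _) → p∈B , β∈B′
  }
  where
  open Bipartition P
  open Graph Γ

{-# OPTIONS --safe #-}

-- A point lies on exactly one block of each parallel class, because N is
-- transitive on points and blocks of a class are disjoint.  Hence Γ(x) is in
-- bijection with the r classes.  Since N fixes every class and G = N G_x, an
-- element of G carrying one pair of blocks through x to another can be
-- corrected by N to fix x, which gives 2-transitivity on Γ(x).
--
-- If an element of G fixed one side of the bipartition pointwise and moved a
-- vertex v of the other side, then v and its image would have the same
-- neighbours; by pairwise transitivity any two vertices of that side with a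
-- common neighbour would too, making Γ complete bipartite, against diameter
-- at least 4.  So both actions are faithful.  Consequently N ≠ 1 moves a
-- block, so some class has two blocks, and all the orbits counted by the ranks
-- are nonempty, apart from the non-collinear point pairs.

module Submission where

open import Data.Empty using (⊥; ⊥-elim)
open import Data.Fin.Base using (Fin; zero; suc)
open import Data.Fin.Properties using (any?) renaming (_≟_ to _≟F_)
open import Data.Fin.Subset using (Subset; _∈_; _⊆_)
open import Data.Fin.Subset.Properties using (_∈?_; x∈p⇒x∉∁p; x∉p⇒x∈∁p)
open import Data.Nat.Base using (ℕ; suc; _≤_; z≤n; s≤s)
open import Data.Nat.Properties using (≤-trans)
open import Data.Product.Base using (∃; ∃-syntax; _×_; _,_; proj₁; proj₂)
open import Data.Sum.Base using (_⊎_; inj₁; inj₂; swap)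
open import Data.Vec.Base using (here; there)
open import Function.Base using (_∘_; _on_)
open import Function.Bundles using (_↔_; _⇔_; mk⇔; mk↔ₛ′; mk⤖; Inverse; Injection; Equivalence)
open import Function.Construct.Composition using (_↔-∘_)
open import Function.Construct.Identity using (↔-id)
open import Function.Construct.Symmetry using (↔-sym)
open import Function.Properties.Bijection using (⤖⇒↔)
open import Function.Properties.Inverse using (↔⇒↣)
open import Level using (0ℓ)
open import Relation.Binary.Core using (Rel)
open import Relation.Binary.Definitions using (DecidableEquality) renaming (Decidable to Decidable₂)
open import Relation.Binary.PropositionalEquality
  using (_≡_; _≢_; refl; sym; trans; cong; subst; subst₂)
open import Relation.Nullary.Decidable using (Dec; yes; no; map′; ¬?; _×-dec_; decidable-stable)
open import Relation.Nullary.Negation using (¬_)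
open import Relation.Unary using (Pred; Decidable)
open import Defs

private
  variable
    A : Set
    n k : ℕ

-- Inverses of permutations

infixr 8 _·⁻¹_

_·⁻¹_ : A ↔ A → A → A
_·⁻¹_ = Inverse.from

·-·⁻¹ : (g : A ↔ A) (x : A) → g · g ·⁻¹ x ≡ x
·-·⁻¹ = Inverse.strictlyInverseˡ

·⁻¹-· : (g : A ↔ A) (x : A) → g ·⁻¹ g · x ≡ x
·⁻¹-· = Inverse.strictlyInverseʳ

·-injective : (g : A ↔ A) {x y : A} → g · x ≡ g · y → x ≡ y
·-injective g = Injection.injective (↔⇒↣ g)

-- Rank

-- The relations `R i` are the orbitals of `H`, so the orbit of `x` under the stabiliser of `a` is
-- named by the index of the relation containing `(a , x)`. Transitivity moves a witness of `R i` to
-- one with first entry `a`, so every index occurs.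
hasRank-orbitals :
  (H : PermGroup A) → A → Transitive H → (R : Fin k → Rel A 0ℓ) →
  (∀ x y → ∃[ i ] R i x y) →
  (∀ {i j x y} → R i x y → R j x y → i ≡ j) →
  (∀ i → ∃[ x ] ∃[ y ] R i x y) →
  (∀ i → TransitiveOnPairs H (R i)) →
  (∀ i {g x y} → H ∋ g → R i x y → R i (g · x) (g · y)) →
  HasRank H k
hasRank-orbitals H o transitive R cover disjoint nonempty onPairs invariant =
  o , transitive , orbits
  where
  orbits : ∀ a → HasOrbits (Stab H a) _
  orbits a = colour , surjective , λ x y → mk⇔ (sameOrbit x y) (sameColour x y)
    where
    colour : _ → Fin _
    colour x = proj₁ (cover a x)

    surjective : ∀ i → ∃[ x ] (∀ {z} → z ≡ x → colour z ≡ i)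
    surjective i with nonempty i
    ... | p , q , pq with transitive p a
    ...   | g , g∈ , refl = g · q , λ { refl →
      disjoint (proj₂ (cover a (g · q))) (invariant i g∈ pq) }

    sameOrbit : ∀ x y → colour x ≡ colour y → SameOrbit (Stab H a) x y
    sameOrbit x y e
      with onPairs _ (proj₂ (cover a x))
                     (subst (λ i → R i a y) (sym e) (proj₂ (cover a y)))
    ... | g , g∈ , ga , gx = g , (g∈ , ga) , gx

    sameColour : ∀ x y → SameOrbit (Stab H a) x y → colour x ≡ colour y
    sameColour x y (g , (g∈ , ga) , gx) =
      disjoint (subst₂ (R _) ga gx (invariant _ g∈ (proj₂ (cover a x))))
               (proj₂ (cover a y))

module _ (H : PermGroup A) (_≟_ : DecidableEquality A) where

  diagonalOnPairs : Transitive H → TransitiveOnPairs H _≡_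
  diagonalOnPairs transitive {x} {.x} {y} refl refl with transitive x y
  ... | g , g∈ , gx = g , g∈ , gx , gx

  ≢-onPairs⇒transitive : TransitiveOnPairs H _≢_ → Transitive H
  ≢-onPairs⇒transitive onPairs x y with x ≟ y
  ... | yes x≡y = ↔-id _ , PermGroup.id-mem H , x≡y
  -- Swapping the pair `(x , y)` to `(y , x)` already carries `x` to `y`.
  ... | no x≢y with onPairs x≢y (x≢y ∘ sym)
  ...   | g , g∈ , gx , _ = g , g∈ , gx

  ≢-onPairs⇒twoTransitive :
    (∃[ x ] ∃[ y ] x ≢ y) → TransitiveOnPairs H _≢_ → TwoTransitive H
  ≢-onPairs⇒twoTransitive (o , o′ , o≢o′) onPairs =
    hasRank-orbitals H o transitive R cover disjoint nonempty trans-R invariant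
    where
    transitive : Transitive H
    transitive = ≢-onPairs⇒transitive onPairs

    R : Fin 2 → Rel A 0ℓ
    R zero       = _≡_
    R (suc zero) = _≢_

    cover : ∀ x y → ∃[ i ] R i x y
    cover x y with x ≟ y
    ... | yes x≡y = zero , x≡y
    ... | no  x≢y = suc zero , x≢y

    disjoint : ∀ {i j x y} → R i x y → R j x y → i ≡ j
    disjoint {zero}     {zero}     _ _ = refl
    disjoint {zero}     {suc zero} p q = ⊥-elim (q p)
    disjoint {suc zero} {zero}     p q = ⊥-elim (p q)
    disjoint {suc zero} {suc zero} _ _ = refl

    nonempty : ∀ i → ∃[ x ] ∃[ y ] R i x y
    nonempty zero       = o , o , refl
    nonempty (suc zero) = o , o′ , o≢o′

    trans-R : ∀ i → TransitiveOnPairs H (R i)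
    trans-R zero       = diagonalOnPairs transitive
    trans-R (suc zero) = onPairs

    invariant : ∀ i {g x y} → H ∋ g → R i x y → R i (g · x) (g · y)
    invariant zero       {g} _ p = cong (g ·_) p
    invariant (suc zero) {g} _ p = p ∘ ·-injective g

  Near Far : Rel A 0ℓ → Rel A 0ℓ
  Near S x y = x ≢ y × S x y
  Far  S x y = x ≢ y × ¬ S x y

  -- The orbitals are equality, `Near S` and `Far S`; deciding `S` is what makes them cover all
  -- pairs.
  rank3 : (S : Rel A 0ℓ) → Decidable₂ S → Transitive H →
          (∀ {g x y} → H ∋ g → S x y → S (g · x) (g · y)) →
          (∃[ x ] ∃[ y ] Near S x y) → (∃[ x ] ∃[ y ] Far S x y) →
          TransitiveOnPairs H (Near S) → TransitiveOnPairs H (Far S) →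
          HasRank H 3
  rank3 S S? transitive S-inv near@(o , _) far nearOnPairs farOnPairs =
    hasRank-orbitals H o transitive R cover disjoint nonempty trans-R invariant
    where
    R : Fin 3 → Rel A 0ℓ
    R zero             = _≡_
    R (suc zero)       = Near S
    R (suc (suc zero)) = Far S

    cover : ∀ x y → ∃[ i ] R i x y
    cover x y with x ≟ y | S? x y
    ... | yes x≡y | _      = zero , x≡y
    ... | no x≢y  | yes s  = suc zero , x≢y , s
    ... | no x≢y  | no  ¬s = suc (suc zero) , x≢y , ¬s

    disjoint : ∀ {i j x y} → R i x y → R j x y → i ≡ j
    disjoint {zero}           {zero}           _       _       = refl
    disjoint {zero}           {suc zero}       p       (q , _) = ⊥-elim (q p)
    disjoint {zero}           {suc (suc zero)} p       (q , _) = ⊥-elim (q p)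
    disjoint {suc zero}       {zero}           (p , _) q       = ⊥-elim (p q)
    disjoint {suc zero}       {suc zero}       _       _       = refl
    disjoint {suc zero}       {suc (suc zero)} (_ , p) (_ , q) = ⊥-elim (q p)
    disjoint {suc (suc zero)} {zero}           (p , _) q       = ⊥-elim (p q)
    disjoint {suc (suc zero)} {suc zero}       (_ , p) (_ , q) = ⊥-elim (p q)
    disjoint {suc (suc zero)} {suc (suc zero)} _       _       = refl

    nonempty : ∀ i → ∃[ x ] ∃[ y ] R i x y
    nonempty zero             = o , o , refl
    nonempty (suc zero)       = near
    nonempty (suc (suc zero)) = far

    trans-R : ∀ i → TransitiveOnPairs H (R i)
    trans-R zero             = diagonalOnPairs transitive
    trans-R (suc zero)       = nearOnPairs
    trans-R (suc (suc zero)) = farOnPairs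

    invariant : ∀ i {g x y} → H ∋ g → R i x y → R i (g · x) (g · y)
    invariant zero             {g} _  p       = cong (g ·_) p
    invariant (suc zero)       {g} g∈ (p , s) = p ∘ ·-injective g , S-inv g∈ s
    -- Invariance of the negation: an `S`-relation between the images is pulled back along the
    -- inverse of `g`.
    invariant (suc (suc zero)) {g} {x} {y} g∈ (p , ¬s) =
      p ∘ ·-injective g ,
      λ s → ¬s (subst₂ S (·⁻¹-· g x) (·⁻¹-· g y)
                         (S-inv (PermGroup.inv-mem H g∈) s))

-- Restriction to invariant subsets

-- Makes elements of `⟦ X ⟧` equal as soon as the underlying vertices are.
∈-irrelevant : {X : Subset n} {x : Fin n} (p q : x ∈ X) → p ≡ q
∈-irrelevant here      here      = refl
∈-irrelevant (there p) (there q) = cong there (∈-irrelevant p q)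

⟦⟧-≡ : {X : Subset n} {u v : ⟦ X ⟧} → proj₁ u ≡ proj₁ v → u ≡ v
⟦⟧-≡ {u = _ , p} {_ , q} refl = cong (_ ,_) (∈-irrelevant p q)

⟦⟧-≟ : {X : Subset n} → DecidableEquality ⟦ X ⟧
⟦⟧-≟ u v = map′ ⟦⟧-≡ (cong proj₁) (proj₁ u ≟F proj₁ v)

⟦⟧-any? : {X : Subset n} {P : Pred ⟦ X ⟧ 0ℓ} → Decidable P → Dec (∃ P)
⟦⟧-any? {X = X} {P} P? =
  map′ (λ (x , x∈ , p) → (x , x∈) , p) (λ ((x , x∈) , p) → x , x∈ , p) (any? P′?)
  where
  P′? : ∀ x → Dec (∃[ x∈ ] P (x , x∈))
  P′? x with x ∈? X
  ... | no  x∉ = no (x∉ ∘ proj₁)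
  ... | yes x∈ = map′ (x∈ ,_) (λ (_ , p) → subst P (⟦⟧-≡ refl) p) (P? (x , x∈))

module _ (G : PermGroup (Fin n)) {X : Subset n} (invariant : Invariant G X) where
  open PermGroup G

  restrict : ∀ {g} → G ∋ g → ⟦ X ⟧ ↔ ⟦ X ⟧
  restrict {g} g∈ = mk↔ₛ′
    (λ (x , x∈) → g · x , invariant g∈ x∈)
    (λ (x , x∈) → g ·⁻¹ x , invariant (inv-mem g∈) x∈)
    (λ u → ⟦⟧-≡ (·-·⁻¹ g (proj₁ u)))
    (λ u → ⟦⟧-≡ (·⁻¹-· g (proj₁ u)))

  restrict-mem : ∀ {g} (g∈ : G ∋ g) → (G ^ X) ∋ restrict g∈
  restrict-mem {g} g∈ = g , g∈ , λ _ → refl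

  -- Every member of `G ^ X` comes with an element of `G` inducing it, so restriction is onto;
  -- `agree` is exactly its injectivity.
  faithful : (∀ {g h} → G ∋ g → G ∋ h → (∀ {x} → x ∈ X → g · x ≡ h · x) → g ≈ h) →
             Faithful G X
  faithful agree = (λ (_ , g∈) → restrict g∈ , restrict-mem g∈) , record
    { isGroupMonomorphism = record
      { isGroupHomomorphism = record
        { isMonoidHomomorphism = record
          { isMagmaHomomorphism = record
            { isRelHomomorphism = record { cong = λ g≈h u → ⟦⟧-≡ (g≈h (proj₁ u)) }
            ; homo = λ _ _ _ → ⟦⟧-≡ refl
            }
          ; ε-homo = λ _ → ⟦⟧-≡ refl
          }
        ; ⁻¹-homo = λ _ _ → ⟦⟧-≡ refl
        }
      ; injective = λ {g} {h} e →
          agree (proj₂ g) (proj₂ h) (λ {x} x∈ → cong proj₁ (e (x , x∈)))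
      }
    ; surjective = λ (π , g , g∈ , r) → (g , g∈) , λ {h} h≈g u →
        ⟦⟧-≡ (trans (h≈g (proj₁ u)) (sym (r u)))
    } , λ _ _ → refl

  sameOrbit-^ : ∀ {u v} → SameOrbit G (proj₁ u) (proj₁ v) → SameOrbit (G ^ X) u v
  sameOrbit-^ (g , g∈ , gx) = restrict g∈ , restrict-mem g∈ , ⟦⟧-≡ gx

  onPairs-^ : {R : Rel (Fin n) 0ℓ} →
              TransitiveOnPairs G (λ x y → x ∈ X × y ∈ X × R x y) →
              TransitiveOnPairs (G ^ X) (R on proj₁)
  onPairs-^ onPairs {_ , x∈} {_ , y∈} {_ , x′∈} {_ , y′∈} r r′
    with onPairs (x∈ , y∈ , r) (x′∈ , y′∈ , r′)
  ... | g , g∈ , gx , gy = restrict g∈ , restrict-mem g∈ , ⟦⟧-≡ gx , ⟦⟧-≡ gy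

sameOrbit-^⁻ : (G : PermGroup (Fin n)) {X : Subset n} {u v : ⟦ X ⟧} →
               SameOrbit (G ^ X) u v → SameOrbit G (proj₁ u) (proj₁ v)
sameOrbit-^⁻ _ {u = u} (π , (g , g∈ , r) , πu) = g , g∈ , trans (sym (r u)) (cong proj₁ πu)

-- If `h` takes `x` to `y`, its conjugate by `g` takes `g · x` to `g · y`; hence `G` permutes the
-- orbits of `N`.
sameOrbit-⊴ : {G N : PermGroup A} → N ⊴ G → ∀ {g x y} → G ∋ g →
              SameOrbit N x y → SameOrbit N (g · x) (g · y)
sameOrbit-⊴ (_ , conj) {g} {x} g∈ (h , h∈ , hx) =
  g ↔-∘ (h ↔-∘ ↔-sym g) , conj g∈ h∈ ,
  cong (g ·_) (trans (cong (h ·_) (·⁻¹-· g x)) hx)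

-- One side of the bipartition

-- Symmetric in `X` and `Y`, unlike `Bipartition`, so that each result about one side applies to
-- points and to blocks.
record Sides (Γ : Graph n) (X Y : Subset n) : Set where
  open Graph Γ
  field
    cover    : ∀ x → x ∈ X ⊎ x ∈ Y
    disjoint : ∀ {x} → x ∈ X → x ∈ Y → ⊥
    nbrX⊆Y   : ∀ {x} → x ∈ X → nbr x ⊆ Y
    nbrY⊆X   : ∀ {x} → x ∈ Y → nbr x ⊆ X

sides-sym : {Γ : Graph n} {X Y : Subset n} → Sides Γ X Y → Sides Γ Y X
sides-sym s = record
  { cover    = λ x → swap (cover x)
  ; disjoint = λ p q → disjoint q p
  ; nbrX⊆Y   = nbrY⊆X
  ; nbrY⊆X   = nbrX⊆Y
  }
  where
  open Sides s

bipartition-sides : {Γ : Graph n} (P : Bipartition Γ) →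
                    Sides Γ (Bipartition.B P) (Bipartition.B′ P)
bipartition-sides P = record
  { cover    = cover
  ; disjoint = x∈p⇒x∉∁p
  ; nbrX⊆Y   = nbrX⊆Y
  ; nbrY⊆X   = nbrY⊆X
  }
  where
  open Bipartition P

  cover : ∀ x → x ∈ B ⊎ x ∈ B′
  cover x with x ∈? B
  ... | yes p = inj₁ p
  ... | no  p = inj₂ (x∉p⇒x∈∁p p)

  nbrX⊆Y : ∀ {x} → x ∈ B → _
  nbrX⊆Y x∈B e with edges e
  ... | inj₁ (_ , y∈B′) = y∈B′
  ... | inj₂ (x∈B′ , _) = ⊥-elim (x∈p⇒x∉∁p x∈B x∈B′)

  nbrY⊆X : ∀ {x} → x ∈ B′ → _
  nbrY⊆X x∈B′ e with edges e
  ... | inj₁ (x∈B , _) = ⊥-elim (x∈p⇒x∉∁p x∈B x∈B′)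
  ... | inj₂ (_ , y∈B) = y∈B

-- For distinct vertices this is collinearity on `B` and intersection on `B′`.
Share : Graph n → Rel (Fin n) 0ℓ
Share Γ x y = ∃[ z ] z ∈ nbr x × z ∈ nbr y
  where open Graph Γ

share? : (Γ : Graph n) → Decidable₂ (Share Γ)
share? Γ x y = any? (λ z → z ∈? nbr x ×-dec z ∈? nbr y)
  where open Graph Γ

share-aut : (Γ : Graph n) → ∀ {g x y} → Aut Γ ∋ g →
            Share Γ x y → Share Γ (g · x) (g · y)
share-aut Γ {g} aut (z , zx , zy) =
  g · z , Equivalence.to (aut _ z) zx , Equivalence.to (aut _ z) zy

nbr-·⁻¹ : (Γ : Graph n) → ∀ {g x y} → Aut Γ ∋ g →
          y ∈ Graph.nbr Γ (g · x) → g ·⁻¹ y ∈ Graph.nbr Γ x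
nbr-·⁻¹ Γ {g} {x} {y} aut e =
  Equivalence.from (aut x (g ·⁻¹ y)) (subst (_∈ Graph.nbr Γ (g · x)) (sym (·-·⁻¹ g y)) e)

-- Connected bipartite graphs of diameter at least 4

LargeDiameter : Graph n → Set
LargeDiameter Γ = ∃[ d ] Diameter Γ d × 4 ≤ d

module _ {Γ : Graph n} (connected : Connected Γ) (large : LargeDiameter Γ) where
  open Graph Γ

  private
    -- A pair of vertices realising the diameter, hence at distance at least 4.
    u v : Fin n
    u = proj₁ (proj₁ (proj₁ (proj₂ large)))
    v = proj₁ (proj₂ (proj₁ (proj₁ (proj₂ large))))

    no-walk : ∀ {j} → suc j ≤ 4 → ¬ Walk Γ j u v
    no-walk j<4 = proj₂ (proj₂ (proj₂ (proj₁ (proj₁ (proj₂ large)))))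
                        (≤-trans j<4 (proj₂ (proj₂ large)))

    u≢v : u ≢ v
    u≢v u≡v = no-walk (s≤s z≤n) (subst (Walk Γ 0 u) u≡v stop)

  walk-start : ∀ {k x y} → x ≢ y → Walk Γ k x y → ∃[ z ] z ∈ nbr x
  walk-start x≢y stop       = ⊥-elim (x≢y refl)
  walk-start x≢y (step e _) = _ , e

  -- At least one of `u` and `v` differs from `x`, and a walk to it begins with an edge at `x`.
  neighbour : ∀ x → ∃[ y ] y ∈ nbr x
  neighbour x with x ≟F u
  ... | no  x≢u = walk-start x≢u (proj₂ (connected x u))
  ... | yes x≡u = walk-start (u≢v ∘ trans (sym x≡u)) (proj₂ (connected x v))

  module _ {X Y : Subset n} (sides : Sides Γ X Y) where
    open Sides sides

    -- In a complete bipartite graph `u` and `v` would be joined by a walk of length 1 or 2,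
    -- depending on their sides.
    not-complete : ¬ (∀ {x y} → x ∈ X → y ∈ Y → y ∈ nbr x)
    not-complete complete with cover u | cover v | neighbour u
    ... | inj₁ u∈X | inj₂ v∈Y | _ =
      no-walk (s≤s (s≤s z≤n)) (step (complete u∈X v∈Y) stop)
    ... | inj₂ u∈Y | inj₁ v∈X | _ =
      no-walk (s≤s (s≤s z≤n)) (step (symmetric (complete v∈X u∈Y)) stop)
    ... | inj₁ u∈X | inj₁ v∈X | z , e =
      no-walk (s≤s (s≤s (s≤s z≤n)))
        (step e (step (symmetric (complete v∈X (nbrX⊆Y u∈X e))) stop))
    ... | inj₂ u∈Y | inj₂ v∈Y | z , e =
      no-walk (s≤s (s≤s (s≤s z≤n))) (step e (step (complete (nbrY⊆X u∈Y e) v∈Y) stop))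

    -- Otherwise a walk from `x` to `y` shortens by two steps at a time: its third vertex `x′`
    -- shares a neighbour with `x`, so whatever is adjacent to `x′` is adjacent to `x`. Induction on
    -- the walk then makes the graph complete bipartite.
    not-all-twins : ¬ (∀ {x y} → x ∈ X → y ∈ X → x ≢ y → Share Γ x y → nbr x ⊆ nbr y)
    not-all-twins twins =
      not-complete (λ {x} {y} x∈ y∈ → adjacent x∈ y∈ (proj₂ (connected x y)))
      where
      adjacent : ∀ {k x y} → x ∈ X → y ∈ Y → Walk Γ k x y → y ∈ nbr x
      adjacent x∈ y∈ stop                = ⊥-elim (disjoint x∈ y∈)
      adjacent x∈ y∈ (step e stop)       = e
      adjacent {x = x} x∈ y∈ (step {y = z} e (step {y = x′} e′ w)) with x′ ≟F x
      ... | yes refl = adjacent x∈ y∈ w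
      ... | no x′≢x  =
        twins x′∈ x∈ x′≢x (z , symmetric e′ , e) (adjacent x′∈ y∈ w)
        where
        x′∈ : x′ ∈ X
        x′∈ = nbrY⊆X (nbrX⊆Y x∈ e) e′

    -- Faithfulness and rank on one side

    module _ (G : PermGroup (Fin n)) (G≤Aut : G ≤ᴳ Aut Γ) (invariant : Invariant G X)
             (nearOnPairs : TransitiveOnPairs G
               (λ x y → x ∈ X × y ∈ X × x ≢ y × Share Γ x y)) where

      -- The neighbours of `x` lie in `Y`, so they have the same images under `g` and `h`, and
      -- `g · x` has no neighbours beyond those of `h · x`. Were the two images distinct,
      -- `nearOnPairs` would carry this inclusion to every near pair, against `not-all-twins`.
      agree-off : ∀ {g h} → G ∋ g → G ∋ h → (∀ {y} → y ∈ Y → g · y ≡ h · y) → g ≈ h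
      agree-off {g} {h} g∈ h∈ agree x with cover x
      ... | inj₂ x∈Y = agree x∈Y
      ... | inj₁ x∈X = decidable-stable (g · x ≟F h · x) (not-all-twins ∘ twins)
        where
        gx⊆hx : nbr (g · x) ⊆ nbr (h · x)
        gx⊆hx {y} e = subst (_∈ nbr (h · x))
          (trans (sym (agree (nbrX⊆Y x∈X e′))) (·-·⁻¹ g y))
          (Equivalence.to (G≤Aut h∈ x (g ·⁻¹ y)) e′)
          where
          e′ : g ·⁻¹ y ∈ nbr x
          e′ = nbr-·⁻¹ Γ {g} (G≤Aut g∈) e

        share : Share Γ (g · x) (h · x)
        share with neighbour x
        ... | z , e = g · z , gz∈ , gx⊆hx gz∈
          where
          gz∈ : g · z ∈ nbr (g · x)
          gz∈ = Equivalence.to (G≤Aut g∈ x z) e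

        twins : g · x ≢ h · x →
                ∀ {u v} → u ∈ X → v ∈ X → u ≢ v → Share Γ u v → nbr u ⊆ nbr v
        twins gx≢hx u∈ v∈ u≢v s {w} e
          with nearOnPairs (invariant g∈ x∈X , invariant h∈ x∈X , gx≢hx , share)
                           (u∈ , v∈ , u≢v , s)
        ... | k , k∈ , refl , refl = subst (_∈ nbr (k · h · x)) (·-·⁻¹ k w)
          (Equivalence.to (G≤Aut k∈ (h · x) (k ·⁻¹ w))
                          (gx⊆hx (nbr-·⁻¹ Γ {k} (G≤Aut k∈) e)))

      module _ (transitive : TransitiveOn G (_∈ X))
               (farOnPairs : TransitiveOnPairs G
                 (λ x y → x ∈ X × y ∈ X × x ≢ y × ¬ Share Γ x y)) where

        private
          S : Rel ⟦ X ⟧ 0ℓ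
          S = Share Γ on proj₁

          S? : Decidable₂ S
          S? u v = share? Γ (proj₁ u) (proj₁ v)

        ^-transitive : Transitive (G ^ X)
        ^-transitive (x , x∈) (y , y∈) = sameOrbit-^ G invariant (transitive x∈ y∈)

        -- Without such a pair the twin condition would hold vacuously, against `not-all-twins`.
        near : ∃[ u ] ∃[ v ] u ≢ v × S u v
        near with ⟦⟧-any? (λ u → ⟦⟧-any? (λ v → ¬? (⟦⟧-≟ u v) ×-dec S? u v))
        ... | yes p = p
        ... | no ¬p = ⊥-elim (not-all-twins λ {x} {y} x∈ y∈ x≢y s →
          ⊥-elim (¬p ((x , x∈) , (y , y∈) , x≢y ∘ cong proj₁ , s)))

        ^-rank3 : (∃[ u ] ∃[ v ] u ≢ v × ¬ S u v) → HasRank (G ^ X) 3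
        ^-rank3 far = rank3 (G ^ X) ⟦⟧-≟ S S? ^-transitive
          (λ {π} {u} {v} (g , g∈ , r) s →
            subst₂ (Share Γ) (sym (r u)) (sym (r v)) (share-aut Γ {g} (G≤Aut g∈) s))
          near far
          (λ (p , s) (p′ , s′) → onPairs-^ G invariant nearOnPairs
            (p ∘ ⟦⟧-≡ , s) (p′ ∘ ⟦⟧-≡ , s′))
          (λ (p , s) (p′ , s′) → onPairs-^ G invariant farOnPairs
            (p ∘ ⟦⟧-≡ , s) (p′ ∘ ⟦⟧-≡ , s′))

        -- The rank drops to 2 exactly when no far pair exists; then any two distinct vertices are
        -- near, and `nearOnPairs` is 2-transitivity.
        ^-rank2⊎3 : HasRank (G ^ X) 2 ⊎ HasRank (G ^ X) 3
        ^-rank2⊎3 with ⟦⟧-any? (λ u → ⟦⟧-any? (λ v → ¬? (⟦⟧-≟ u v) ×-dec ¬? (S? u v)))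
        ... | yes far = inj₂ (^-rank3 far)
        ... | no ¬far with near
        ...   | u , v , u≢v , _ = inj₁ (≢-onPairs⇒twoTransitive (G ^ X) ⟦⟧-≟ (u , v , u≢v)
          λ p p′ → onPairs-^ G invariant nearOnPairs
            (p ∘ ⟦⟧-≡ , shared p) (p′ ∘ ⟦⟧-≡ , shared p′))
          where
          shared : ∀ {u v} → u ≢ v → S u v
          shared {u} {v} p = decidable-stable (S? u v) λ ¬s → ¬far (u , v , p , ¬s)

-- The adjacency design

theorem1p5 :
    ∀ {n} (Γ : Graph n) (P : Bipartition Γ) → Connected Γ →
    (G N : PermGroup (Fin n)) → G ≤ᴳ Aut Γ → N ⊴ G → ¬ IsTrivial N →
    (r : ℕ) → 3 ≤ r →
    let open Graph Γ
        open Bipartition P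
        D = adjacencyDesign P
    in
    Starlike P r N × LocallyDistanceTransitive Γ G 4 →
    PairwiseTransitive D G × NicelyAffine D N × HasParallelClasses D N r →
    Faithful G B
    × (HasRank (G ^ B) 2 ⊎ HasRank (G ^ B) 3)
    × Faithful G B′
    × Imprimitive (G ^ B′) × HasRank (G ^ B′) 3
    × (∀ x → x ∈ B →
         TwoTransitive (Stab G x ^ nbr x) × HasDegree (Stab G x ^ nbr x) r)
theorem1p5 {n} Γ P connected G N G≤Aut N⊴G N≢1 r@(suc (suc _)) (s≤s (s≤s _)) (_ , ldt)
  (pairwise , affine , class , class-surj , class⇔orbit) =
    -- The sides are swapped: agreement on `B` must force agreement on `B′`, so `agree-off` is
    -- applied with `B′` as `X` and block intersection as the near relation.
    faithful G B-inv (agree-off connected large (sides-sym sides) G G≤Aut B′-inv intersecting)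
  , ^-rank2⊎3 connected large sides G G≤Aut B-inv collinear B-trans nonCollinear
  , faithful G B′-inv B′-determines
  , imprimitive
  , ^-rank3 connected large (sides-sym sides) G G≤Aut B′-inv intersecting B′-trans
      nonIntersecting nonIntersectingPair
  , λ x x∈B → twoTransitive x∈B , degree x∈B
  where
  open Graph Γ
  open Bipartition P

  D : Design n
  D = adjacencyDesign P

  module Pairwise = PairwiseTransitive pairwise
  module Affine = NicelyAffine affine

  large : LargeDiameter Γ
  large = LocallyDistanceTransitive.diameter≥s ldt

  sides : Sides Γ B B′
  sides = bipartition-sides P
  open Sides sides

  N≤G : N ≤ᴳ G
  N≤G = proj₁ N⊴G

  B-inv : Invariant G B
  B-inv g∈ = Equivalence.to (IsDesignAut.points-pres (Pairwise.automorphisms g∈) _)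

  B′-inv : Invariant G B′
  B′-inv g∈ = Equivalence.to (IsDesignAut.blocks-pres (Pairwise.automorphisms g∈) _)

  -- Pairwise transitivity in terms of common neighbours

  shareB⇔ : ∀ {p q} → p ∈ B → q ∈ B →
    Share Γ p q ⇔ (∃[ β ] Design._I_ D p β × Design._I_ D q β)
  shareB⇔ p∈ q∈ = mk⇔
    (λ (β , e , f) → β , (p∈ , nbrX⊆Y p∈ e , e) , (q∈ , nbrX⊆Y p∈ e , f))
    (λ (β , (_ , _ , e) , (_ , _ , f)) → β , e , f)

  shareB′⇔ : ∀ {β γ} → β ∈ B′ → γ ∈ B′ →
    Share Γ β γ ⇔ (∃[ p ] Design._I_ D p β × Design._I_ D p γ)
  shareB′⇔ β∈ γ∈ = mk⇔
    (λ (p , e , f) → p , (nbrY⊆X β∈ e , β∈ , symmetric e) , (nbrY⊆X β∈ e , γ∈ , symmetric f))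
    (λ (p , (_ , _ , e) , (_ , _ , f)) → p , symmetric e , symmetric f)

  collinear : TransitiveOnPairs G (λ x y → x ∈ B × y ∈ B × x ≢ y × Share Γ x y)
  collinear (x , y , ne , s) (x′ , y′ , ne′ , s′) = Pairwise.collinear
    (x , y , ne , Equivalence.to (shareB⇔ x y) s)
    (x′ , y′ , ne′ , Equivalence.to (shareB⇔ x′ y′) s′)

  nonCollinear : TransitiveOnPairs G (λ x y → x ∈ B × y ∈ B × x ≢ y × ¬ Share Γ x y)
  nonCollinear (x , y , ne , s) (x′ , y′ , ne′ , s′) = Pairwise.nonCollinear
    (x , y , ne , s ∘ Equivalence.from (shareB⇔ x y))
    (x′ , y′ , ne′ , s′ ∘ Equivalence.from (shareB⇔ x′ y′))

  intersecting : TransitiveOnPairs G (λ x y → x ∈ B′ × y ∈ B′ × x ≢ y × Share Γ x y)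
  intersecting (x , y , ne , s) (x′ , y′ , ne′ , s′) = Pairwise.intersecting
    (x , y , ne , Equivalence.to (shareB′⇔ x y) s)
    (x′ , y′ , ne′ , Equivalence.to (shareB′⇔ x′ y′) s′)

  nonIntersecting : TransitiveOnPairs G (λ x y → x ∈ B′ × y ∈ B′ × x ≢ y × ¬ Share Γ x y)
  nonIntersecting (x , y , ne , s) (x′ , y′ , ne′ , s′) = Pairwise.nonIntersecting
    (x , y , ne , s ∘ Equivalence.from (shareB′⇔ x y))
    (x′ , y′ , ne′ , s′ ∘ Equivalence.from (shareB′⇔ x′ y′))

  B-trans : TransitiveOn G (_∈ B)
  B-trans x∈ y∈ with Affine.transitive x∈ y∈
  ... | h , h∈ , hx = h , N≤G h∈ , hx

  -- Every block has a point on it, so transitivity on incident pairs suffices.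
  B′-trans : TransitiveOn G (_∈ B′)
  B′-trans {β} {γ} β∈ γ∈
    with neighbour connected large β | neighbour connected large γ
  ... | p , e | q , f
    with Pairwise.incident
           (nbrY⊆X β∈ e , β∈ , nbrY⊆X β∈ e , β∈ , symmetric e)
           (nbrY⊆X γ∈ f , γ∈ , nbrY⊆X γ∈ f , γ∈ , symmetric f)
  ... | g , g∈ , _ , gβ = g , g∈ , gβ

  B′-determines : ∀ {g h} → G ∋ g → G ∋ h → (∀ {β} → β ∈ B′ → g · β ≡ h · β) → g ≈ h
  B′-determines = agree-off connected large sides G G≤Aut B-inv collinear

  -- Parallel classes

  parallel-disjoint : ∀ {β γ} → β ∈ B′ → γ ∈ B′ → β ≢ γ → SameOrbit N β γ → ¬ Share Γ β γ
  parallel-disjoint β∈ γ∈ β≢γ o = Affine.same β∈ γ∈ β≢γ o ∘ Equivalence.to (shareB′⇔ β∈ γ∈)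

  parallel-≡ : ∀ {x β γ} → x ∈ B → β ∈ nbr x → γ ∈ nbr x → SameOrbit N β γ → β ≡ γ
  parallel-≡ {x} {β} {γ} x∈ e f o = decidable-stable (β ≟F γ) λ β≢γ →
    parallel-disjoint (nbrX⊆Y x∈ e) (nbrX⊆Y x∈ f) β≢γ o (x , symmetric e , symmetric f)

  class⇒orbit : ∀ {u v} → class u ≡ class v → SameOrbit N (proj₁ u) (proj₁ v)
  class⇒orbit {u} {v} e = sameOrbit-^⁻ N (Equivalence.to (class⇔orbit u v) e)

  orbit⇒class : ∀ {u v} → SameOrbit N (proj₁ u) (proj₁ v) → class u ≡ class v
  orbit⇒class {u} {v} o =
    Equivalence.from (class⇔orbit u v) (sameOrbit-^ N (B′-inv ∘ N≤G) o)

  -- If all classes were singletons, `N` would fix every block and so be trivial by `B′-determines`.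
  parallelPair : ∃[ u ] ∃[ v ] u ≢ v × class u ≡ class v
  parallelPair
    with ⟦⟧-any? (λ u → ⟦⟧-any? (λ v → ¬? (⟦⟧-≟ u v) ×-dec (class u ≟F class v)))
  ... | yes p = p
  ... | no ¬p = ⊥-elim (N≢1 λ {g} g∈ →
    B′-determines (N≤G g∈) (PermGroup.id-mem G) (fixes g∈))
    where
    fixes : ∀ {g β} → N ∋ g → β ∈ B′ → g · β ≡ β
    fixes {g} {β} g∈ β∈ = decidable-stable (g · β ≟F β) λ gβ≢β →
      ¬p ( (β , β∈) , (g · β , B′-inv (N≤G g∈) β∈)
         , gβ≢β ∘ sym ∘ cong proj₁ , orbit⇒class (g , g∈ , refl))

  nonIntersectingPair : ∃[ u ] ∃[ v ] u ≢ v × ¬ Share Γ (proj₁ u) (proj₁ v)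
  nonIntersectingPair with parallelPair
  ... | u , v , u≢v , e =
    u , v , u≢v , parallel-disjoint (proj₂ u) (proj₂ v) (u≢v ∘ ⟦⟧-≡) (class⇒orbit e)

  -- Matching `r` as `suc (suc _)` provides these two class indices. They yield blocks in different
  -- classes and, through `degree`, two distinct blocks on a point.
  0≢1 : _≢_ {A = Fin r} zero (suc zero)
  0≢1 ()

  -- The invariant partition consists of the parallel classes, which `G` permutes because `N` is
  -- normal.
  imprimitive : Imprimitive (G ^ B′)
  imprimitive =
      (λ (_ , β∈) (_ , γ∈) → sameOrbit-^ G B′-inv (B′-trans β∈ γ∈))
    , (λ u v → class u ≡ class v)
    , record { refl = refl ; sym = sym ; trans = trans }
    , (λ {_} {u} {v} (g , g∈ , res) e → orbit⇒class
        (subst₂ (SameOrbit N) (sym (res u)) (sym (res v))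
                (sameOrbit-⊴ {G = G} {N = N} N⊴G g∈ (class⇒orbit e))))
    , parallelPair
    , differentPair
    where
    differentPair : ∃[ u ] ∃[ v ] class u ≢ class v
    differentPair with class-surj zero | class-surj (suc zero)
    ... | u , cu | v , cv = u , v , λ e → 0≢1 (trans (sym (cu refl)) (trans e (cv refl)))

  -- Action of a point stabiliser on the blocks through the point

  degree : ∀ {x} → x ∈ B → ⟦ nbr x ⟧ ↔ Fin r
  degree {x} x∈ = ⤖⇒↔ (mk⤖ {to = to} (injective , surjective))
    where
    to : ⟦ nbr x ⟧ → Fin r
    to (β , e) = class (β , nbrX⊆Y x∈ e)

    injective : ∀ {u v} → to u ≡ to v → u ≡ v
    injective {_ , e} {_ , f} p = ⟦⟧-≡ (parallel-≡ x∈ e f (class⇒orbit p))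

    -- Take any block `γ` of class `i` and a point `p` on it; an element of `N` moving `p` to `x`
    -- takes `γ` to a block through `x` of the same class.
    surjective : ∀ i → ∃[ u ] (∀ {v} → v ≡ u → to v ≡ i)
    surjective i with class-surj i
    ... | (γ , γ∈) , cγ with neighbour connected large γ
    ...   | p , e with Affine.transitive (nbrY⊆X γ∈ e) x∈
    ...     | h , h∈ , refl =
      (h · γ , Equivalence.to (G≤Aut (N≤G h∈) p γ) (symmetric e)) ,
      λ { refl → trans (sym (orbit⇒class (h , h∈ , refl))) (cγ refl) }

  twoTransitive : ∀ {x} → x ∈ B → TwoTransitive (Stab G x ^ nbr x)
  twoTransitive {x} x∈ = ≢-onPairs⇒twoTransitive (Stab G x ^ nbr x) ⟦⟧-≟
    (from zero , from (suc zero) , 0≢1 ∘ Injection.injective (↔⇒↣ (↔-sym (degree x∈))))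
    (λ p p′ → onPairs-^ (Stab G x) nbr-inv onPairs (p ∘ ⟦⟧-≡) (p′ ∘ ⟦⟧-≡))
    where
    open Inverse (degree x∈) using (from)

    nbr-inv : Invariant (Stab G x) (nbr x)
    nbr-inv {g} {β} (g∈ , gx) e =
      subst (λ y → g · β ∈ nbr y) gx (Equivalence.to (G≤Aut g∈ x β) e)

    onPairs : TransitiveOnPairs (Stab G x) (λ β γ → β ∈ nbr x × γ ∈ nbr x × β ≢ γ)
    onPairs {β} {γ} (β∈ , γ∈ , β≢γ) (β′∈ , γ′∈ , β′≢γ′)
      with intersecting
             (nbrX⊆Y x∈ β∈ , nbrX⊆Y x∈ γ∈ , β≢γ , x , symmetric β∈ , symmetric γ∈)
             (nbrX⊆Y x∈ β′∈ , nbrX⊆Y x∈ γ′∈ , β′≢γ′ , x , symmetric β′∈ , symmetric γ′∈)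
    -- `g` maps the first pair of blocks to the second but may move `x`; `h` in `N` brings `g · x`
    -- back to `x`.
    ... | g , g∈ , refl , refl with Affine.transitive (B-inv g∈ x∈) x∈
    ...   | h , h∈ , hgx = h ↔-∘ g , hg∈ , fixes β∈ β′∈ , fixes γ∈ γ′∈
      where
      hg∈ : Stab G x ∋ h ↔-∘ g
      hg∈ = PermGroup.comp-mem G (N≤G h∈) g∈ , hgx

      -- The correction by `h` does no harm: `g · δ` and its image under `h` are parallel blocks
      -- through `x`, hence equal.
      fixes : ∀ {δ} → δ ∈ nbr x → g · δ ∈ nbr x → h · g · δ ≡ g · δ
      fixes δ∈ gδ∈ = sym (parallel-≡ x∈ gδ∈ (nbr-inv hg∈ δ∈) (h , h∈ , refl))
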